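{- Let $G=(V,E)$ be a finite undirected graph, let $\tau:\mathbb{Z}_+\to\mathbb{Z}_+$ be a non-increasing function, and let $f^{\mathrm{grace}}(S):=\min\{\ell\in\mathbb{Z}_+:\tau(\ell)<|S|\}$ for $\emptyset\neq S\subseteq V$. (a) The function $f^{\mathrm{grace}}$ is weakly supermodular. (b) $H\subseteq E$ is feasible for CR-$f^{\mathrm{grace}}$-NDP if and only if for every fault-set $F\subseteq E$, and every $S\subseteq V$ with $|S|\le\tau(|F|)$, $S$ is (the node-set of) a component of $G-F$ if and only if it is (the node-set of) a component of $H-F$.
   Context: For $S\subseteq V$ and $Z\subseteq E$, $\delta_G(S)$ is the set of edges of $G$ with exactly one end in $S$ and $\delta_Z(S)=\delta_G(S)\cap Z$. An edge set $H\subseteq E$ is identified with the spanning subgraph $(V,H)$; $G-F$ and $H-F$ denote $(V,E\setminus F)$ and $(V,H\setminus F)$; components are connected components. A function $f$ on $2^V$ is weakly supermodular if for all $A,B\subseteq V$, $f(A)+f(B)\le\max\{f(A\cap B)+f(A\cup B),\ f(A-B)+f(B-A)\}$. For such a function $f$, $H\subseteq E$ is feasible for CR-$f$-NDP (cut-relative $f$-network design) if $|\delta_H(S)|\ge\min\{f(S),|\delta_G(S)|\}$ for all $S\subseteq V$. Conventions: $\min\emptyset=+\infty$ (so $f^{\mathrm{grace}}$ may take the value $+\infty$ if $\tau$ never drops below $|S|$), and $f^{\mathrm{grace}}(\emptyset)=0$. -}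

module Defs where

open import Data.Bool using (_xor_)
open import Data.Fin using (Fin; fromℕ<; toℕ)
open import Data.Fin.Properties using (sequence; toℕ-fromℕ<)
open import Data.Fin.Subset using (Subset; _∈_; _∩_; _∪_; _─_; ∣_∣; Nonempty) renaming (⊥ to ∅; ⊤ to full)
open import Data.Fin.Subset.Properties using (∣p∣≤n; nonempty?; Empty-unique; ∉⊥)
open import Data.Maybe using (zipWith)
open import Data.Nat using (ℕ; zero; suc; _+_; _≤_; _<_; _⊓_; _⊔_; z≤n; s≤s)
open import Data.Nat.Properties using (≤-antisym; _<?_)
open import Data.Product using (Σ-syntax; ∃; ∃-syntax; _×_; _,_; proj₁; proj₂)
open import Data.Sum using (_⊎_)
open import Data.Vec using (lookup; tabulate)
open import Effect.Monad using (RawMonad)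
open import Function using (_∘_; _⇔_)
open import Level using (0ℓ)
open import Relation.Binary.Construct.Add.Supremum.NonStrict _≤_ using (_≤⁺_)
open import Relation.Binary.Construct.Closure.ReflexiveTransitive using (Star)
open import Relation.Binary.PropositionalEquality using (_≡_; refl; cong; subst)
open import Relation.Nullary using (¬_; Dec; yes; no; contradiction)
open import Relation.Nullary.Construct.Add.Supremum using (_⁺; [_]; ⊤⁺)
open import Relation.Nullary.Decidable using (¬¬-excluded-middle)
open import Relation.Nullary.Negation using (¬¬-map; ¬¬-Monad)
open import Relation.Unary using (Pred; Decidable)

------------------------------------------------------------------------
-- Graphs

-- A finite undirected graph on the vertex set Fin n.  Edges are named by
-- Fin #E, so loops and parallel edges are allowed, and an edge set is a
-- Subset #E.  The order of the two ends of an edge is irrelevant to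
-- everything below.
record Graph (n : ℕ) : Set where
  field
    #E   : ℕ
    ends : Fin #E → Fin n × Fin n

  EdgeSet : Set
  EdgeSet = Subset #E

  -- The whole edge set E; the spanning subgraph (V , E) is the graph itself.
  E : EdgeSet
  E = full

  -- δ Z S is δ_Z(S); in particular δ E S is δ_G(S).
  δ : EdgeSet → Subset n → EdgeSet
  δ Z S = tabulate crosses ∩ Z
    where
    crosses = λ e → lookup S (proj₁ (ends e)) xor lookup S (proj₂ (ends e))

  Adjacent : EdgeSet → Fin n → Fin n → Set
  Adjacent Z u v = ∃[ e ] e ∈ Z × (ends e ≡ (u , v) ⊎ ends e ≡ (v , u))

  Reachable : EdgeSet → Fin n → Fin n → Set
  Reachable Z = Star (Adjacent Z)

  -- S is the node set of a connected component of the spanning subgraph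
  -- (V , Z), i.e. the class of some node u under reachability.
  IsComponent : EdgeSet → Subset n → Set
  IsComponent Z S = ∃[ u ] (∀ v → v ∈ S ⇔ Reachable Z u v)

open Graph public

------------------------------------------------------------------------
-- Natural numbers with +∞, written ⊤⁺ (the order is the library's _≤⁺_)

ℕ∞ : Set
ℕ∞ = ℕ ⁺

infixl 6 _+∞_ _⊔∞_
infixl 7 _⊓∞_

-- zipWith returns ⊤⁺ as soon as one argument is ⊤⁺.
_+∞_ : ℕ∞ → ℕ∞ → ℕ∞
_+∞_ = zipWith _+_

_⊔∞_ : ℕ∞ → ℕ∞ → ℕ∞
_⊔∞_ = zipWith _⊔_

_⊓∞_ : ℕ∞ → ℕ∞ → ℕ∞
⊤⁺    ⊓∞ y     = y
[ m ] ⊓∞ ⊤⁺    = [ m ]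
[ m ] ⊓∞ [ n ] = [ m ⊓ n ]

-- IsMin P x : x = min { ℓ ∣ P ℓ }, with min ∅ = +∞.
IsMin : Pred ℕ 0ℓ → ℕ∞ → Set
IsMin P [ ℓ ] = P ℓ × (∀ k → P k → ℓ ≤ k)
IsMin P ⊤⁺    = ∀ k → ¬ P k

------------------------------------------------------------------------
-- Weak supermodularity and cut-relative network design

WeaklySupermodular : ∀ {n} → (Subset n → ℕ∞) → Set
WeaklySupermodular f = ∀ A B →
  (f A +∞ f B) ≤⁺ ((f (A ∩ B) +∞ f (A ∪ B)) ⊔∞ (f (A ─ B) +∞ f (B ─ A)))

Feasible : ∀ {n} (G : Graph n) → (Subset n → ℕ∞) → EdgeSet G → Set
Feasible G f H = ∀ S → (f S ⊓∞ [ ∣ δ G (E G) S ∣ ]) ≤⁺ [ ∣ δ G H S ∣ ]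

NonIncreasing : (ℕ → ℕ) → Set
NonIncreasing τ = ∀ {k ℓ} → k ≤ ℓ → τ ℓ ≤ τ k

-- f is the function f^grace determined by τ.  This is a specification rather
-- than a definition by recursion because whether τ ever drops below ∣ S ∣
-- is not decidable for an arbitrary τ : ℕ → ℕ.
IsGrace : ∀ {n} → (ℕ → ℕ) → (Subset n → ℕ∞) → Set
IsGrace τ f =
  f ∅ ≡ [ 0 ] × (∀ S → Nonempty S → IsMin (λ ℓ → τ ℓ < ∣ S ∣) (f S))

------------------------------------------------------------------------
-- The specification determines f, and is satisfied by some f for every τ
-- (up to ¬¬, by the previous remark).

IsMin-unique : ∀ P {x y} → IsMin P x → IsMin P y → x ≡ y
IsMin-unique P {x = [ k ]} {[ ℓ ]} (pk , k≤) (pℓ , ℓ≤) =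
  cong [_] (≤-antisym (k≤ ℓ pℓ) (ℓ≤ k pk))
IsMin-unique P {x = [ k ]} {⊤⁺}    (pk , _) ¬p       = contradiction pk (¬p k)
IsMin-unique P {x = ⊤⁺}    {[ ℓ ]} ¬p       (pℓ , _) = contradiction pℓ (¬p ℓ)
IsMin-unique P {x = ⊤⁺}    {⊤⁺}    _        _        = refl

IsGrace-unique : ∀ {n τ} {f g : Subset n → ℕ∞} →
                 IsGrace τ f → IsGrace τ g → ∀ S → f S ≡ g S
IsGrace-unique (f∅ , fmin) (g∅ , gmin) S with nonempty? S
... | yes ne = IsMin-unique _ (fmin S ne) (gmin S ne)
... | no ¬ne rewrite Empty-unique ¬ne | f∅ | g∅ = refl

least : ∀ {P : Pred ℕ 0ℓ} → Decidable P → ∀ ℓ → P ℓ →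
        ∃[ m ] P m × (∀ k → P k → m ≤ k)
least P? ℓ p with P? 0
... | yes p₀ = 0 , p₀ , λ _ _ → z≤n
least P? zero    p | no ¬p₀ = contradiction p ¬p₀
least P? (suc ℓ) p | no ¬p₀ with least (P? ∘ suc) ℓ p
... | m , pm , m≤ = suc m , pm , λ where
  zero    p₀ → contradiction p₀ ¬p₀
  (suc k) pk → s≤s (m≤ k pk)

IsMin-exists : ∀ {P} → Decidable P → ¬ ¬ ∃ (IsMin P)
IsMin-exists {P} P? = ¬¬-map min ¬¬-excluded-middle
  where
  min : Dec (∃ P) → ∃ (IsMin P)
  min (yes (ℓ , p)) = let m , pm = least P? ℓ p in [ m ] , pm
  min (no  ¬∃)      = ⊤⁺ , λ k p → ¬∃ (k , p)

IsGrace-exists : ∀ n τ → ¬ ¬ (Σ[ f ∈ (Subset n → ℕ∞) ] IsGrace τ f)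
IsGrace-exists n τ = ¬¬-map build
  (sequence (RawMonad.rawApplicative ¬¬-Monad) λ i → IsMin-exists λ ℓ → τ ℓ <? toℕ i)
  where
  build : ((i : Fin (suc n)) → ∃ (IsMin (λ ℓ → τ ℓ < toℕ i))) →
          Σ[ f ∈ (Subset n → ℕ∞) ] IsGrace τ f
  build g = f , f∅ , fmin
    where
    size : (S : Subset n) → Σ[ i ∈ Fin (suc n) ] toℕ i ≡ ∣ S ∣
    size S = fromℕ< (s≤s (∣p∣≤n S)) , toℕ-fromℕ< (s≤s (∣p∣≤n S))

    f : Subset n → ℕ∞
    f S with nonempty? S
    ... | yes _ = proj₁ (g (proj₁ (size S)))
    ... | no  _ = [ 0 ]

    f∅ : f ∅ ≡ [ 0 ]
    f∅ with nonempty? {n} ∅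
    ... | yes (_ , x∈∅) = contradiction x∈∅ ∉⊥
    ... | no  _ = refl

    fmin : ∀ S → Nonempty S → IsMin (λ ℓ → τ ℓ < ∣ S ∣) (f S)
    fmin S ne with nonempty? S
    ... | yes _  = subst (λ s → IsMin (λ ℓ → τ ℓ < s) (proj₁ (g (proj₁ (size S)))))
                         (proj₂ (size S)) (proj₂ (g (proj₁ (size S))))
    ... | no ¬ne = contradiction ne ¬ne

{-# OPTIONS --safe #-}
-- (a) If A − B and B − A are both nonempty, then f A ≤ f (A − B) and
-- f B ≤ f (B − A) because f^grace decreases along inclusion of nonempty sets;
-- otherwise A and B are comparable and {A ∩ B, A ∪ B} = {A, B}.
--
-- (b) For nonempty S, f S ≤ m says τ m < ∣ S ∣.  So if H is feasible and T is
-- a component of H − F with ∣ T ∣ ≤ τ ∣ F ∣, then ∣ δ_H(T) ∣ ≤ ∣ F ∣ < f T, which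
-- forces δ_G(T) = δ_H(T) ⊆ F: no edge of G − F leaves T.  Conversely, if
-- ∣ δ_H(S) ∣ < f S, take F = δ_H(S): the components of H − F meeting S lie
-- inside S, hence are components of G − F, so no edge of G − F leaves S and
-- δ_G(S) ⊆ δ_H(S).
module Submission where

open import Defs
open import Data.Bool using (Bool; true; false; _xor_)
open import Data.Fin using (Fin)
open import Data.Fin.Subset
  using (Subset; _∈_; _∉_; _⊆_; _⊃_; _∩_; _∪_; _─_; ∣_∣; ⁅_⁆; Nonempty; inside; outside)
open import Data.Fin.Subset.Induction using (Acc; acc; ⊃-wellFounded)
open import Data.Fin.Subset.Properties
  using (_∈?_; nonempty?; Empty-unique; ∈⊤; x∈⁅x⁆; x∈⁅y⁆⇒x≡y; ⊆-antisym; p⊆q⇒∣p∣≤∣q∣;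
         p⊂q⇒∣p∣<∣q∣; p∩q⊆p; x∈p∩q⁺; x∈p∩q⁻; p⊆p∪q; q⊆p∪q; x∈p∪q⁻;
         ∩-comm; ∪-comm; x∈p∧x∉q⇒x∈p─q; p─q⊆p)
open import Data.Nat using (ℕ; _≤_; _<_; z≤n)
open import Data.Nat.Properties
  using (≤-trans; ≤-<-trans; <-≤-trans; ≤-total; _≤?_; <⇒≱; ≮⇒≥;
         +-mono-≤; +-comm; m≤m⊔n; m≤n⊔m; m≤n⇒m⊓n≡m; m≥n⇒m⊓n≡n; m⊓n≤m; m⊓n≤n)
open import Data.Product using (∃-syntax; _×_; _,_; proj₁; proj₂)
open import Data.Sum using (_⊎_; inj₁; inj₂)
open import Data.Vec using (lookup; tabulate; _∷_; here; there)
open import Data.Vec.Properties using ([]=⇒lookup; lookup⇒[]=; lookup∘tabulate)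
open import Function using (_⇔_; mk⇔; Equivalence)
open import Level using (0ℓ)
open import Relation.Binary.Construct.Add.Supremum.NonStrict _≤_ as ≤⁺ using (_≤⁺_; _≤⊤⁺)
open import Relation.Binary.Construct.Closure.ReflexiveTransitive as Star using (ε; _◅_; _▻▻_; return)
open import Relation.Binary.PropositionalEquality
  using (_≡_; refl; sym; trans; cong; subst)
open import Relation.Nullary using (¬_; yes; no; contradiction)
open import Relation.Nullary.Construct.Add.Supremum using ([_]; ⊤⁺)
open import Relation.Nullary.Decidable using (decidable-stable)
open import Relation.Unary using (Pred)

open Equivalence using (to; from)

private
  variable
    n : ℕ

-- Finite subsets: difference, inclusion and cardinality

x∈p─q⇒x∉q : ∀ (p q : Subset n) {x} → x ∈ p ─ q → x ∉ q
x∈p─q⇒x∉q (_ ∷ p) (inside  ∷ q) ()        here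
x∈p─q⇒x∉q (_ ∷ p) (inside  ∷ q) (there x∈) (there x∈q) = x∈p─q⇒x∉q p q x∈ x∈q
x∈p─q⇒x∉q (_ ∷ p) (outside ∷ q) (there x∈) (there x∈q) = x∈p─q⇒x∉q p q x∈ x∈q

p─q-empty⇒p⊆q : ∀ (p q : Subset n) → ¬ Nonempty (p ─ q) → p ⊆ q
p─q-empty⇒p⊆q p q empty {x} x∈p =
  decidable-stable (x ∈? q) λ x∉q → empty (x , x∈p∧x∉q⇒x∈p─q x∈p x∉q)

p⊆q⇒p∩q≡p : ∀ {p q : Subset n} → p ⊆ q → p ∩ q ≡ p
p⊆q⇒p∩q≡p {p = p} {q} p⊆q = ⊆-antisym (p∩q⊆p p q) λ x∈p → x∈p∩q⁺ (x∈p , p⊆q x∈p)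

p⊆q⇒p∪q≡q : ∀ {p q : Subset n} → p ⊆ q → p ∪ q ≡ q
p⊆q⇒p∪q≡q {p = p} {q} p⊆q = ⊆-antisym ∪⊆ (q⊆p∪q p q)
  where
  ∪⊆ : p ∪ q ⊆ q
  ∪⊆ x∈ with x∈p∪q⁻ p q x∈
  ... | inj₁ x∈p = p⊆q x∈p
  ... | inj₂ x∈q = x∈q

p⊆q∧∣q∣≤∣p∣⇒q⊆p : ∀ {p q : Subset n} → p ⊆ q → ∣ q ∣ ≤ ∣ p ∣ → q ⊆ p
p⊆q∧∣q∣≤∣p∣⇒q⊆p {p = p} p⊆q ∣q∣≤∣p∣ {x} x∈q = decidable-stable (x ∈? p)
  λ x∉p → <⇒≱ (p⊂q⇒∣p∣<∣q∣ (p⊆q , x , x∈q , x∉p)) ∣q∣≤∣p∣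

-- Arithmetic and minima in the naturals with infinity

+∞-mono-≤⁺ : ∀ {w x y z} → w ≤⁺ x → y ≤⁺ z → (w +∞ y) ≤⁺ (x +∞ z)
+∞-mono-≤⁺ ≤⁺.[ w≤x ] ≤⁺.[ y≤z ]       = ≤⁺.[ +-mono-≤ w≤x y≤z ]
+∞-mono-≤⁺ ≤⁺.[ _ ]   (_ ≤⊤⁺)          = _ ≤⊤⁺
+∞-mono-≤⁺ (_ ≤⊤⁺)    _                = _ ≤⊤⁺

+∞-comm : ∀ x y → x +∞ y ≡ y +∞ x
+∞-comm [ k ] [ ℓ ] = cong [_] (+-comm k ℓ)
+∞-comm [ _ ] ⊤⁺    = refl
+∞-comm ⊤⁺    [ _ ] = refl
+∞-comm ⊤⁺    ⊤⁺    = refl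

x≤⁺x⊔∞y : ∀ x y → x ≤⁺ (x ⊔∞ y)
x≤⁺x⊔∞y [ k ] [ ℓ ] = ≤⁺.[ m≤m⊔n k ℓ ]
x≤⁺x⊔∞y [ _ ] ⊤⁺    = _ ≤⊤⁺
x≤⁺x⊔∞y ⊤⁺    _     = _ ≤⊤⁺

y≤⁺x⊔∞y : ∀ x y → y ≤⁺ (x ⊔∞ y)
y≤⁺x⊔∞y [ k ] [ ℓ ] = ≤⁺.[ m≤n⊔m k ℓ ]
y≤⁺x⊔∞y [ _ ] ⊤⁺    = _ ≤⊤⁺
y≤⁺x⊔∞y ⊤⁺    _     = _ ≤⊤⁺

⊓∞≤⁺⁺ : ∀ x {k m} → x ≤⁺ [ m ] ⊎ k ≤ m → (x ⊓∞ [ k ]) ≤⁺ [ m ]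
⊓∞≤⁺⁺ [ ℓ ] {k} (inj₁ ≤⁺.[ ℓ≤m ]) = ≤⁺.[ ≤-trans (m⊓n≤m ℓ k) ℓ≤m ]
⊓∞≤⁺⁺ [ ℓ ] {k} (inj₂ k≤m)        = ≤⁺.[ ≤-trans (m⊓n≤n ℓ k) k≤m ]
⊓∞≤⁺⁺ ⊤⁺        (inj₂ k≤m)        = ≤⁺.[ k≤m ]

⊓∞≤⁺⁻ : ∀ x {k m} → (x ⊓∞ [ k ]) ≤⁺ [ m ] → x ≤⁺ [ m ] ⊎ k ≤ m
⊓∞≤⁺⁻ ⊤⁺        ≤⁺.[ k≤m ] = inj₂ k≤m
⊓∞≤⁺⁻ [ ℓ ] {k} {m} ≤⁺.[ ℓ⊓k≤m ] with ≤-total ℓ k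
... | inj₁ ℓ≤k = inj₁ ≤⁺.[ subst (_≤ m) (m≤n⇒m⊓n≡m ℓ≤k) ℓ⊓k≤m ]
... | inj₂ k≤ℓ = inj₂ (subst (_≤ m) (m≥n⇒m⊓n≡n k≤ℓ) ℓ⊓k≤m)

IsMin-antitone : ∀ {P Q : Pred ℕ 0ℓ} {x y} → (∀ k → P k → Q k) →
                 IsMin P x → IsMin Q y → y ≤⁺ x
IsMin-antitone {x = ⊤⁺}              _   _       _       = _ ≤⊤⁺
IsMin-antitone {x = [ k ]} {[ ℓ ]}   P⊆Q (p , _) (_ , ℓ≤) = ≤⁺.[ ℓ≤ k (P⊆Q k p) ]
IsMin-antitone {x = [ k ]} {⊤⁺}      P⊆Q (p , _) ¬q      = contradiction (P⊆Q k p) (¬q k)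

-- Upward closure makes `P` the ray that starts at its minimum; the value `⊤⁺` stands for the empty
-- ray.
IsMin-≤⁺⇔ : ∀ {P : Pred ℕ 0ℓ} {x} → (∀ {k ℓ} → k ≤ ℓ → P k → P ℓ) →
            IsMin P x → ∀ m → x ≤⁺ [ m ] ⇔ P m
IsMin-≤⁺⇔ {x = [ ℓ ]} up (p , ℓ≤) m = mk⇔ (λ { ≤⁺.[ ℓ≤m ] → up ℓ≤m p }) λ pm → ≤⁺.[ ℓ≤ m pm ]
IsMin-≤⁺⇔ {x = ⊤⁺}    up ¬p       m = mk⇔ (λ ()) λ pm → contradiction pm (¬p m)

-- The grace function and its weak supermodularity

module _ {τ : ℕ → ℕ} {f : Subset n → ℕ∞} (grace : IsGrace τ f) where

  -- The condition `τ ℓ < ∣ S ∣` weakens as `S` grows. The empty set is excluded because its value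
  -- is 0 by convention.
  grace-antitone : ∀ {S T} → Nonempty S → S ⊆ T → f T ≤⁺ f S
  grace-antitone {S} {T} (u , u∈S) S⊆T =
    IsMin-antitone (λ _ τk<∣S∣ → <-≤-trans τk<∣S∣ (p⊆q⇒∣p∣≤∣q∣ S⊆T))
                   (proj₂ grace S (u , u∈S)) (proj₂ grace T (u , S⊆T u∈S))

  grace-≤⁺⇔ : NonIncreasing τ → ∀ {S} → Nonempty S → ∀ m → f S ≤⁺ [ m ] ⇔ τ m < ∣ S ∣
  grace-≤⁺⇔ τ↓ {S} ne = IsMin-≤⁺⇔ (λ k≤ℓ → ≤-<-trans (τ↓ k≤ℓ)) (proj₂ grace S ne)

  grace-weaklySupermodular : WeaklySupermodular f
  grace-weaklySupermodular A B with nonempty? (A ─ B) | nonempty? (B ─ A)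
  ... | yes ne | yes ne′ =
    ≤⁺.≤⁺-trans ≤-trans
      (+∞-mono-≤⁺ (grace-antitone ne (p─q⊆p A B)) (grace-antitone ne′ (p─q⊆p B A)))
      (y≤⁺x⊔∞y (f (A ∩ B) +∞ f (A ∪ B)) _)
  -- Here `A ⊆ B`, so the first argument of the maximum becomes `f A +∞ f B` itself.
  ... | no empty | _
    rewrite p⊆q⇒p∩q≡p (p─q-empty⇒p⊆q A B empty) | p⊆q⇒p∪q≡q (p─q-empty⇒p⊆q A B empty) =
    x≤⁺x⊔∞y (f A +∞ f B) _
  ... | yes _ | no empty
    rewrite ∩-comm A B | ∪-comm A B | +∞-comm (f A) (f B)
          | p⊆q⇒p∩q≡p (p─q-empty⇒p⊆q B A empty) | p⊆q⇒p∪q≡q (p─q-empty⇒p⊆q B A empty) =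
    x≤⁺x⊔∞y (f B +∞ f A) _

-- Cuts, closed sets and components

module _ (G : Graph n) where

  -- The edgewise form of `S` being a union of components of `(V , Z)`.
  Closed : EdgeSet G → Subset n → Set
  Closed Z S = ∀ {u v} → u ∈ S → Adjacent G Z u v → v ∈ S

  Closed-reachable : ∀ {Z S u v} → Closed Z S → u ∈ S → Reachable G Z u v → v ∈ S
  Closed-reachable cl u∈S ε        = u∈S
  Closed-reachable cl u∈S (a ◅ as) = Closed-reachable cl (cl u∈S a) as

  Reachable-mono : ∀ {Y Z} → Y ⊆ Z → ∀ {u v} → Reachable G Y u v → Reachable G Z u v
  Reachable-mono Y⊆Z = Star.map λ (e , e∈Y , joins) → e , Y⊆Z e∈Y , joins

  crosses : Subset n → Fin (#E G) → Bool
  crosses S e = lookup S (proj₁ (ends G e)) xor lookup S (proj₂ (ends G e))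

  ∈δ⁺ : ∀ {Z S e u v} → e ∈ Z → ends G e ≡ (u , v) ⊎ ends G e ≡ (v , u) →
        u ∈ S → v ∉ S → e ∈ δ G Z S
  ∈δ⁺ {Z} {S} {e} {u} {v} e∈Z joins u∈S v∉S =
    x∈p∩q⁺ (lookup⇒[]= e _ (trans (lookup∘tabulate (crosses S) e) (crossing joins)) , e∈Z)
    where
    lookup-v : lookup S v ≡ outside
    lookup-v with lookup S v in eq
    ... | true  = contradiction (lookup⇒[]= v S eq) v∉S
    ... | false = refl

    crossing : ends G e ≡ (u , v) ⊎ ends G e ≡ (v , u) → crosses S e ≡ true
    crossing (inj₁ eq) rewrite eq | []=⇒lookup u∈S | lookup-v = refl
    crossing (inj₂ eq) rewrite eq | []=⇒lookup u∈S | lookup-v = refl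

  ∈δ⁻ : ∀ {Z S e} → e ∈ δ G Z S →
        e ∈ Z × ∃[ u ] ∃[ v ] (ends G e ≡ (u , v) ⊎ ends G e ≡ (v , u)) × u ∈ S × v ∉ S
  ∈δ⁻ {Z} {S} {e} e∈δ = e∈Z , orient
    where
    e∈ = x∈p∩q⁻ (tabulate (crosses S)) Z e∈δ
    e∈Z = proj₂ e∈

    crossing : crosses S e ≡ true
    crossing = trans (sym (lookup∘tabulate (crosses S) e)) ([]=⇒lookup (proj₁ e∈))

    outside⇒∉ : ∀ {w} → lookup S w ≡ outside → w ∉ S
    outside⇒∉ eq w∈S with () ← trans (sym eq) ([]=⇒lookup w∈S)

    orient : ∃[ u ] ∃[ v ] (ends G e ≡ (u , v) ⊎ ends G e ≡ (v , u)) × u ∈ S × v ∉ S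
    -- When both ends lie on the same side, the xor is false and `crossing` is absurd.
    orient with lookup S (proj₁ (ends G e)) in eq₁ | lookup S (proj₂ (ends G e)) in eq₂ | crossing
    ... | true  | false | _ = _ , _ , inj₁ refl , lookup⇒[]= _ S eq₁ , outside⇒∉ eq₂
    ... | false | true  | _ = _ , _ , inj₂ refl , lookup⇒[]= _ S eq₂ , outside⇒∉ eq₁

  δ-mono : ∀ {Y Z} S → Y ⊆ Z → δ G Y S ⊆ δ G Z S
  δ-mono S Y⊆Z e∈δ = let e∈Y , _ , _ , joins , u∈S , v∉S = ∈δ⁻ {S = S} e∈δ in ∈δ⁺ (Y⊆Z e∈Y) joins u∈S v∉S

  -- The bridge between cuts, which feasibility counts, and connectivity after a fault: an edge of
  -- `Z` leaving `S` survives exactly when it is not in `F`.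
  δ⊆⇔Closed : ∀ {Z F S} → δ G Z S ⊆ F ⇔ Closed (Z ─ F) S
  δ⊆⇔Closed {Z} {F} {S} = mk⇔ closed δ⊆
    where
    closed : δ G Z S ⊆ F → Closed (Z ─ F) S
    closed δ⊆F {v = v} u∈S (e , e∈Z─F , joins) = decidable-stable (v ∈? S)
      λ v∉S → x∈p─q⇒x∉q Z F e∈Z─F (δ⊆F (∈δ⁺ (p─q⊆p Z F e∈Z─F) joins u∈S v∉S))

    δ⊆ : Closed (Z ─ F) S → δ G Z S ⊆ F
    δ⊆ cl {e} e∈δ = decidable-stable (e ∈? F) λ e∉F →
      let e∈Z , _ , _ , joins , u∈S , v∉S = ∈δ⁻ e∈δ
      in v∉S (cl u∈S (e , x∈p∧x∉q⇒x∈p─q e∈Z e∉F , joins))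

  IsComponent⇒Nonempty : ∀ {Z S} → IsComponent G Z S → Nonempty S
  IsComponent⇒Nonempty (u , S⇔) = u , from (S⇔ u) ε

  IsComponent⇒Closed : ∀ {Z S} → IsComponent G Z S → Closed Z S
  IsComponent⇒Closed (_ , S⇔) {u} {v} u∈S adj = from (S⇔ v) (return adj ▻▻ to (S⇔ u) u∈S)

  -- Starting from `u` alone, the far end of some edge leaving `T` is added until the cut is empty.
  -- Each round enlarges `T` strictly, so well-foundedness of `⊃` gives termination.
  component : ∀ Z u → ∃[ T ] (∀ v → v ∈ T ⇔ Reachable G Z u v)
  component Z u = grow ⁅ u ⁆ (⊃-wellFounded _) (x∈⁅x⁆ u) λ v∈ →
    subst (Reachable G Z u) (sym (x∈⁅y⁆⇒x≡y u v∈)) ε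
    where
    grow : ∀ T → Acc _⊃_ T → u ∈ T → (∀ {v} → v ∈ T → Reachable G Z u v) →
           ∃[ T ] (∀ v → v ∈ T ⇔ Reachable G Z u v)
    grow T (acc rec) u∈T reach with nonempty? (δ G Z T)
    ... | no empty = T , λ v → mk⇔ reach (Closed-reachable closed u∈T)
      where
      closed : Closed Z T
      closed {v = y} x∈T (e , e∈Z , joins) =
        decidable-stable (y ∈? T) λ y∉T → empty (e , ∈δ⁺ e∈Z joins x∈T y∉T)
    ... | yes (e , e∈δ) with e∈Z , x , y , joins , x∈T , y∉T ← ∈δ⁻ {Z} {T} e∈δ =
      grow (T ∪ ⁅ y ⁆) (rec (p⊆p∪q ⁅ y ⁆ , y , q⊆p∪q T ⁅ y ⁆ (x∈⁅x⁆ y) , y∉T))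
           (p⊆p∪q ⁅ y ⁆ u∈T) reach′
      where
      reach′ : ∀ {v} → v ∈ T ∪ ⁅ y ⁆ → Reachable G Z u v
      reach′ v∈ with x∈p∪q⁻ T ⁅ y ⁆ v∈
      ... | inj₁ v∈T = reach v∈T
      ... | inj₂ v∈y rewrite x∈⁅y⁆⇒x≡y y v∈y = return (e , e∈Z , joins) ▻▻ reach x∈T

  SameSmallComponents : (ℕ → ℕ) → EdgeSet G → Set
  SameSmallComponents τ H = ∀ F S → ∣ S ∣ ≤ τ ∣ F ∣ →
    IsComponent G (E G ─ F) S ⇔ IsComponent G (H ─ F) S

  ─-monoˡ : ∀ {Y Z} (F : EdgeSet G) → Y ⊆ Z → (Y ─ F) ⊆ (Z ─ F)
  ─-monoˡ {Y} {Z} F Y⊆Z e∈ = x∈p∧x∉q⇒x∈p─q (Y⊆Z (p─q⊆p Y F e∈)) (x∈p─q⇒x∉q Y F e∈)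

  -- Feasibility and small components

  module _ {τ : ℕ → ℕ} (τ↓ : NonIncreasing τ) {f : Subset n → ℕ∞} (grace : IsGrace τ f)
           (H : EdgeSet G) where

    feasible⇒Closed : Feasible G f H → ∀ F {T} → ∣ T ∣ ≤ τ ∣ F ∣ →
                      IsComponent G (H ─ F) T → Closed (E G ─ F) T
    feasible⇒Closed feas F {T} ∣T∣≤τ comp = to δ⊆⇔Closed δE⊆F
      where
      δH⊆F : δ G H T ⊆ F
      δH⊆F = from δ⊆⇔Closed (IsComponent⇒Closed comp)

      δE⊆F : δ G (E G) T ⊆ F
      δE⊆F with ⊓∞≤⁺⁻ (f T) (feas T)
      -- Then `f T` would be at most `∣ F ∣`, that is, `τ ∣ F ∣ < ∣ T ∣`.
      ... | inj₁ fT≤∣δH∣ = contradiction ∣T∣≤τ (<⇒≱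
        (to (grace-≤⁺⇔ grace τ↓ (IsComponent⇒Nonempty comp) _)
            (≤⁺.≤⁺-trans ≤-trans fT≤∣δH∣ ≤⁺.[ p⊆q⇒∣p∣≤∣q∣ δH⊆F ])))
      -- The cut in `H` is contained in the cut in `G` and is at least as large, so the two
      -- coincide.
      ... | inj₂ ∣δE∣≤∣δH∣ = λ e∈ → δH⊆F (p⊆q∧∣q∣≤∣p∣⇒q⊆p (δ-mono T λ _ → ∈⊤) ∣δE∣≤∣δH∣ e∈)

    feasible⇒same : Feasible G f H → SameSmallComponents τ H
    feasible⇒same feas F S ∣S∣≤τ = mk⇔ E⇒H H⇒E
      where
      weaken : ∀ {u v} → Reachable G (H ─ F) u v → Reachable G (E G ─ F) u v
      weaken = Reachable-mono (─-monoˡ F λ _ → ∈⊤)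

      E⇒H : IsComponent G (E G ─ F) S → IsComponent G (H ─ F) S
      -- The component `T` of `u` in `H ─ F` lies in `S`, so it is small and hence closed in
      -- `E G ─ F`. It therefore contains all that `u` reaches there, namely `S`.
      E⇒H (u , S⇔) with T , T⇔ ← component (H ─ F) u = u , λ v → mk⇔
        (λ v∈S → to (T⇔ v) (Closed-reachable T-closed (from (T⇔ u) ε) (to (S⇔ v) v∈S)))
        (λ r → from (S⇔ v) (weaken r))
        where
        T⊆S : T ⊆ S
        T⊆S v∈T = from (S⇔ _) (weaken (to (T⇔ _) v∈T))

        T-closed : Closed (E G ─ F) T
        T-closed = feasible⇒Closed feas F (≤-trans (p⊆q⇒∣p∣≤∣q∣ T⊆S) ∣S∣≤τ) (u , T⇔)

      H⇒E : IsComponent G (H ─ F) S → IsComponent G (E G ─ F) S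
      H⇒E comp@(u , S⇔) = u , λ v → mk⇔
        (λ v∈S → weaken (to (S⇔ v) v∈S))
        (Closed-reachable (feasible⇒Closed feas F ∣S∣≤τ comp) (from (S⇔ u) ε))

    same⇒Closed : SameSmallComponents τ H → ∀ S → ∣ S ∣ ≤ τ ∣ δ G H S ∣ → Closed (E G ─ δ G H S) S
    -- The fault set is the cut of `S` in `H`, so `T` cannot leave `S` and is small. As `T` is then
    -- also a component of the faulted `G`, the given edge at `u` ends in `T`.
    same⇒Closed same S ∣S∣≤τ {u} u∈S adj with T , T⇔ ← component (H ─ δ G H S) u =
      T⊆S (IsComponent⇒Closed (from (same _ T (≤-trans (p⊆q⇒∣p∣≤∣q∣ T⊆S) ∣S∣≤τ)) (u , T⇔))
                              (from (T⇔ u) ε) adj)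
      where
      T⊆S : T ⊆ S
      T⊆S v∈T = Closed-reachable (to δ⊆⇔Closed λ e∈ → e∈) u∈S (to (T⇔ _) v∈T)

    same⇒feasible : SameSmallComponents τ H → Feasible G f H
    same⇒feasible same S = ⊓∞≤⁺⁺ (f S) bound
      where
      bound : f S ≤⁺ [ ∣ δ G H S ∣ ] ⊎ ∣ δ G (E G) S ∣ ≤ ∣ δ G H S ∣
      bound with nonempty? S
      -- The convention `f ∅ ≡ [ 0 ]` settles the empty set, which `grace-≤⁺⇔` does not cover.
      ... | no empty rewrite Empty-unique empty | proj₁ grace = inj₁ ≤⁺.[ z≤n ]
      ... | yes ne with ≤⁺.≤⁺-dec _≤?_ (f S) [ ∣ δ G H S ∣ ]
      ...   | yes fS≤ = inj₁ fS≤
      -- Failure of the bound on `f S` means `∣ S ∣ ≤ τ ∣ δ G H S ∣`, the smallness that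
      -- `same⇒Closed` requires.
      ...   | no  fS≰ = inj₂ (p⊆q⇒∣p∣≤∣q∣ (from δ⊆⇔Closed (same⇒Closed same S
                (≮⇒≥ λ τ<∣S∣ → fS≰ (from (grace-≤⁺⇔ grace τ↓ ne _) τ<∣S∣)))))

theorem3p1 : ∀ {n} (G : Graph n) (τ : ℕ → ℕ) → NonIncreasing τ →
    ∀ (f : Subset n → ℕ∞) → IsGrace τ f →
    WeaklySupermodular f
    × (∀ (H : EdgeSet G) →
    Feasible G f H
    ⇔ (∀ (F : EdgeSet G) (S : Subset n) → ∣ S ∣ ≤ τ ∣ F ∣ →
    (IsComponent G (E G ─ F) S ⇔ IsComponent G (H ─ F) S)))
theorem3p1 G τ τ↓ f grace =
  grace-weaklySupermodular grace ,
  λ H → mk⇔ (feasible⇒same G τ↓ grace H) (same⇒feasible G τ↓ grace H)
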